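{- Let $q\ge 3$ be a prime such that $p=\frac{q-1}{2}$ is odd. Then the mixed graph $G_{p,q}$ (defined in the context) is a $\left[\frac{p+1}{2},\,q;\,6\right]$-mixed graph; that is, every vertex of $G_{p,q}$ has exactly $\frac{p+1}{2}$ in-arcs, exactly $\frac{p+1}{2}$ out-arcs and exactly $q$ edges, and $G_{p,q}$ has girth $6$.
   Context: Mixed graphs. A mixed graph $G=(V;E\cup A)$ has a finite vertex set $V$, a set $E$ of (undirected) edges $uv$ and a set $A$ of arcs $(u,v)$; it is simple: no parallel arcs, no parallel edges, and no arc parallel to an edge. Walks, paths and cycles are sequences of vertices in which each consecutive pair $v_i,v_{i+1}$ is joined by the arc $(v_i,v_{i+1})$ or by the edge $v_iv_{i+1}$ (arcs are traversed in their direction, edges in either direction; a cycle is closed, has no repeated vertices, and traversing a single edge back and forth is not a cycle). The girth is the length of a shortest cycle. For $z,r\ge 0$, a $[z,r;g]$-mixed graph is a mixed graph in which every vertex has exactly $z$ in-arcs, $z$ out-arcs and $r$ edges, and whose girth is $g$. The graph $B_q$. For a prime $q$, $B_q$ is the undirected bipartite graph with $2q^2$ vertices: the points $(x,y)$ with $x,y\in\mathbb{Z}_q$ and the lines $[m,b]$ with $m,b\in\mathbb{Z}_q$; the line $[m,b]$ and the point $(x,y)$ are joined by an edge if and only if $y=mx+b$ in $\mathbb{Z}_q$. Let $B'_q$ be a disjoint copy of $B_q$, with the copy of $[m,b]$ denoted $[m',b']$ and the copy of $(x,y)$ denoted $(x',y')$. The digraphs $C_m$ and $C_x$. Let $p=\frac{q-1}{2}$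 be odd. For $m\in\mathbb{Z}_q$, $C_m$ is the digraph on the $2q$ vertices $\{[m,b]: b\in\mathbb{Z}_q\}\cup\{[m',b']: b\in\mathbb{Z}_q\}$ whose arcs are, for every $b\in\mathbb{Z}_q$ and every $j\in\{1,3,5,\dots,p\}$, $$\left([m,b],\,[m',(b+\tfrac{j-1}{2})']\right)\quad\text{and}\quad \left([m',b'],\,[m,b+\tfrac{j+1}{2}]\right),$$ with sums modulo $q$. For $x\in\mathbb{Z}_q$, $C_x$ is defined in the same way on the points $\{(x,y): y\in\mathbb{Z}_q\}\cup\{(x',y'): y\in\mathbb{Z}_q\}$: its arcs are $\left((x,y),(x',(y+\tfrac{j-1}{2})')\right)$ and $\left((x',y'),(x,y+\tfrac{j+1}{2})\right)$ for $y\in\mathbb{Z}_q$, $j\in\{1,3,\dots,p\}$. The mixed graph $G_{p,q}$ has vertex set $V(B_q)\cup V(B'_q)$, edge set $E(B_q)\cup E(B'_q)$, and arc set $\bigcup_{m\in\mathbb{Z}_q}A(C_m)\cup\bigcup_{x\in\mathbb{Z}_q}A(C_x)$. -}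

module Defs where

open import Data.Empty using (⊥)
open import Data.Fin.Base using (Fin; toℕ)
open import Data.Nat.Base using (ℕ; suc; _+_; _*_; _∸_; _≤_; NonZero; parity)
open import Data.Nat.DivMod using (_/_; _mod_)
open import Data.Parity.Base using (1ℙ)
open import Data.Product.Base using (∃; ∃-syntax; _×_; _,_)
open import Function.Bundles using (_↔_)
open import Function.Definitions using (Injective)
open import Relation.Binary.Core using (Rel)
open import Relation.Binary.Definitions using (Symmetric; Irreflexive; Irrelevant)
open import Relation.Binary.PropositionalEquality.Core using (_≡_; _≢_)
open import Relation.Nullary.Negation.Core using (¬_)
open import Level using (0ℓ)

Odd : ℕ → Set
Odd n = parity n ≡ 1ℙ

ℤ/ : ℕ → Set
ℤ/ q = Fin q

infixl 6 _⊕_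
infixl 7 _⊗_

_⊕_ _⊗_ : ∀ {q} .{{_ : NonZero q}} → ℤ/ q → ℤ/ q → ℤ/ q
_⊕_ {q} a b = (toℕ a + toℕ b) mod q
_⊗_ {q} a b = (toℕ a * toℕ b) mod q

-- `Edge u v` is the type of edges joining u and v, and `Arc u v` the type of
-- arcs from u to v; their proof irrelevance is the absence of parallel edges
-- and of parallel arcs.
record MixedGraph : Set₁ where
  field
    V    : Set
    Edge : Rel V 0ℓ
    Arc  : Rel V 0ℓ

-- Antiparallel arcs (u , v) and (v , u) are allowed; they form a 2-cycle.
record IsSimple (G : MixedGraph) : Set where
  open MixedGraph G
  field
    finite            : ∃[ n ] (V ↔ Fin n)
    edge-sym          : Symmetric Edge
    no-edge-loop      : Irreflexive _≡_ Edge
    no-arc-loop       : Irreflexive _≡_ Arc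
    no-parallel-edges : Irrelevant Edge
    no-parallel-arcs  : Irrelevant Arc
    no-arc-∥-edge     : ∀ {u v} → Arc u v → ¬ Edge u v

data Step (G : MixedGraph) (u v : MixedGraph.V G) : Set where
  along-arc  : MixedGraph.Arc  G u v → Step G u v
  along-edge : MixedGraph.Edge G u v → Step G u v

data IsEdgeStep {G : MixedGraph} {u v : MixedGraph.V G} : Step G u v → Set where
  is-edge : (e : MixedGraph.Edge G u v) → IsEdgeStep (along-edge e)

next : ∀ {n} .{{_ : NonZero n}} → Fin n → Fin n
next {n} i = suc (toℕ i) mod n

-- The closed walk v₀, v₁, …, vₙ₋₁, v₀, with positions taken modulo n.
-- An edge step followed by an edge step back to the same vertex is the same
-- edge traversed back and forth; as the vertices are distinct, this can only
-- happen for n ≤ 2.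
record Cycle (G : MixedGraph) (n : ℕ) : Set where
  open MixedGraph G
  field
    .{{n≢0}}     : NonZero n
    vertex       : Fin n → V
    distinct     : Injective _≡_ _≡_ vertex
    step         : ∀ i → Step G (vertex i) (vertex (next i))
    no-backtrack : ∀ i → IsEdgeStep (step i) → IsEdgeStep (step (next i)) →
                   vertex (next (next i)) ≢ vertex i

record HasGirth (G : MixedGraph) (g : ℕ) : Set where
  field
    attained : Cycle G g
    shortest : ∀ {n} → Cycle G n → g ≤ n

record Is[_,_⨾_]-MixedGraph (z r g : ℕ) (G : MixedGraph) : Set where
  open MixedGraph G
  field
    simple  : IsSimple G
    inArcs  : ∀ v → (∃[ u ] Arc u v) ↔ Fin z
    outArcs : ∀ v → (∃[ w ] Arc v w) ↔ Fin z
    edges   : ∀ v → (∃[ w ] Edge v w) ↔ Fin r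
    girth   : HasGirth G g

data BVertex (q : ℕ) : Set where
  point : (x y : ℤ/ q) → BVertex q
  line  : (m b : ℤ/ q) → BVertex q

BEdge : ∀ q .{{_ : NonZero q}} → Rel (BVertex q) 0ℓ
BEdge q (point x y) (line m b)  = y ≡ m ⊗ x ⊕ b
BEdge q (line m b)  (point x y) = y ≡ m ⊗ x ⊕ b
BEdge q (point _ _) (point _ _) = ⊥
BEdge q (line _ _)  (line _ _)  = ⊥

data Copy : Set where
  unprimed primed : Copy

-- The common shape of C_m and C_x: (unprimed , b) stands for [m , b]
-- (resp. (x , b)) and (primed , b) for [m′ , b′] (resp. (x′ , b′)).
-- Since j is odd, both divisions by 2 are exact.
CArc : ∀ p q .{{_ : NonZero q}} → Rel (Copy × ℤ/ q) 0ℓ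
CArc p q (unprimed , b) (primed   , c) =
  ∃[ j ] (Odd j × j ≤ p × c ≡ b ⊕ ((j ∸ 1) / 2) mod q)
CArc p q (primed   , b) (unprimed , c) =
  ∃[ j ] (Odd j × j ≤ p × c ≡ b ⊕ ((j + 1) / 2) mod q)
CArc p q (unprimed , _) (unprimed , _) = ⊥
CArc p q (primed   , _) (primed   , _) = ⊥

GVertex : ℕ → Set
GVertex q = Copy × BVertex q

GEdge : ∀ q .{{_ : NonZero q}} → Rel (GVertex q) 0ℓ
GEdge q (c , u) (d , v) = c ≡ d × BEdge q u v

GArc : ∀ p q .{{_ : NonZero q}} → Rel (GVertex q) 0ℓ
GArc p q (c , line m b)  (d , line n b′)  = m ≡ n × CArc p q (c , b) (d , b′)
GArc p q (c , point x y) (d , point w y′) = x ≡ w × CArc p q (c , y) (d , y′)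
GArc p q (_ , line _ _)  (_ , point _ _)  = ⊥
GArc p q (_ , point _ _) (_ , line _ _)   = ⊥

G[_,_] : ∀ p q .{{_ : NonZero q}} → MixedGraph
G[ p , q ] = record
  { V    = GVertex q
  ; Edge = GEdge q
  ; Arc  = GArc p q
  }

{-# OPTIONS --safe #-}
-- Give the vertex with second coordinate b in the copy c the position 2b + [c is primed] in ℤ/2q.
-- An arc keeps the kind and the first coordinate of a vertex (its slot) and adds an odd j ≤ p to
-- the position, so arcs out of (or into) a vertex correspond to the odd j ≤ p. Two edges whose ends
-- lie in the same two slots are translates of each other: their ends differ by the same amount.
--
-- Each step changes either the kind or the copy of a vertex, so closed walks have even length. A
-- closed walk of length 2 or 4 that uses arcs either repeats a vertex or makes a positive sum of at
-- most four jumps a multiple of 2q, whereas 4p < 2q. Four edges would give two points on two common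
-- lines, which Euclid's lemma excludes. A triangle of lines is a cycle of length 6.
module Submission where

open import Defs
open import Axiom.UniquenessOfIdentityProofs.WithK using (uip)
open import Data.Fin.Base using (Fin; zero; suc; toℕ; fromℕ<)
open import Data.Fin.Patterns using (0F; 1F; 2F; 3F; 4F; 5F)
open import Data.Fin.Properties
  using (toℕ<n; toℕ≤n; toℕ-injective; toℕ-fromℕ<; toℕ-combine; +↔⊎; *↔×)
open import Data.Integer.Base as ℤ using (ℤ; +_; -_; ∣_∣)
open import Data.Integer.Divisibility.Signed
  using (_∣_; divides; ∣⇒∣ᵤ; ∣ᵤ⇒∣; ∣m∣n⇒∣m+n; ∣m∣n⇒∣m-n; ∣m⇒∣-m; *-monoˡ-∣)
import Data.Integer.Properties as ℤ
open import Data.Integer.Tactic.RingSolver using (solve-∀)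
open import Data.Nat.Base
  using (ℕ; zero; suc; _+_; _*_; _∸_; _≤_; _<_; z≤n; s≤s; z<s; NonZero; ≢-nonZero⁻¹)
open import Data.Nat.DivMod using (_/_; _%_; _mod_; m≡m%n+[m/n]*n; m%n<n; m*n/n≡m; m/n*n≤m; /-monoˡ-≤)
import Data.Nat.Divisibility as ℕ
import Data.Nat.Properties as ℕ
open import Data.Nat.Primality using (Prime; prime⇒nonZero; euclidsLemma)
open import Data.Parity.Base using (Parity; 0ℙ; 1ℙ; _⁻¹) renaming (_+_ to _ℙ+_)
open import Data.Parity.Properties using (p≢p⁻¹; ⁻¹-involutive)
open import Data.Product.Base using (∃; ∃-syntax; _×_; _,_; proj₁; proj₂)
open import Data.Product.Function.NonDependent.Propositional using (_×-↔_)
open import Data.Sum.Base using (_⊎_; inj₁; inj₂; map; map₂; swap)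
open import Function.Base using (_∘_)
open import Function.Bundles using (_↔_; mk↔ₛ′; Inverse)
open import Function.Properties.Inverse using (↔-sym; ↔-trans)
open import Relation.Binary.PropositionalEquality
open import Relation.Nullary.Negation.Core using (¬_; contradiction)

-- Divisibility and counting tools

∣⇒≡0 : ∀ {n m} → n ℕ.∣ m → m < n → m ≡ 0
∣⇒≡0 {m = zero}  _   _   = refl
∣⇒≡0 {m = suc _} n∣m m<n = contradiction (ℕ.∣⇒≤ n∣m) (ℕ.<⇒≱ m<n)

-- The difference is below `n` in absolute value, so the only multiple of `n` it can be is 0.
-- Congruences are expressed as divisibility in `ℤ`, where combining them comes down to ring
-- identities for the solver.
residue-unique : ∀ {n i j} → i < n → j < n → + n ∣ + i ℤ.- + j → i ≡ j
residue-unique {n} {i} {j} i<n j<n n∣i-j =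
  ℤ.+-injective (ℤ.i-j≡0⇒i≡j _ _ (ℤ.∣i∣≡0⇒i≡0 (∣⇒≡0 (∣⇒∣ᵤ n∣i-j) ∣i-j∣<n)))
  where
  ∣i-j∣<n : ∣ + i ℤ.- + j ∣ < n
  ∣i-j∣<n rewrite ℤ.m-n≡m⊖n i j =
    ℕ.≤-<-trans (ℤ.∣m⊝n∣≤m⊔n i j) (ℕ.⊔-lub i<n j<n)

Fin-residue-unique : ∀ {n} (i j : Fin n) → + n ∣ + toℕ i ℤ.- + toℕ j → i ≡ j
Fin-residue-unique i j = toℕ-injective ∘ residue-unique (toℕ<n i) (toℕ<n j)

-- Passes from second coordinates modulo q to positions modulo 2q.
double-∣ : ∀ {n i} → + n ∣ i → + (n * 2) ∣ i ℤ.* + 2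
double-∣ {n} n∣i rewrite ℤ.pos-* n 2 = *-monoˡ-∣ (+ 2) n∣i

-- Meant for two lines with two common points: `d` and `k` are the differences of slopes and
-- intercepts, `x` and `x′` the abscissae.
affine-difference-∣ : ∀ {n} d x x′ k →
  n ∣ d ℤ.* x ℤ.+ k → n ∣ d ℤ.* x′ ℤ.+ k → n ∣ d ℤ.* (x ℤ.- x′)
affine-difference-∣ {n} d x x′ k n∣ n∣′ =
  subst (n ∣_) (identity d x x′ k) (∣m∣n⇒∣m-n n∣ n∣′)
  where
  identity : ∀ d x x′ k → (d ℤ.* x ℤ.+ k) ℤ.- (d ℤ.* x′ ℤ.+ k) ≡ d ℤ.* (x ℤ.- x′)
  identity = solve-∀

euclidsLemmaℤ : ∀ {q} → Prime q → ∀ i j → + q ∣ i ℤ.* j → (+ q ∣ i) ⊎ (+ q ∣ j)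
euclidsLemmaℤ {q} q-prime i j q∣ij = map ∣ᵤ⇒∣ ∣ᵤ⇒∣
  (euclidsLemma ∣ i ∣ ∣ j ∣ q-prime (subst (q ℕ.∣_) (ℤ.abs-* i j) (∣⇒∣ᵤ q∣ij)))

-- Every degree is counted this way. Irrelevance of `P` makes a pair depend on its first component
-- only, so a label with a section is a bijection once it determines that component.
Σ-↔ : ∀ {A J : Set} {P : A → Set} → (∀ {a} (x y : P a) → x ≡ y) →
      (label : ∃ P → J) (pick : J → ∃ P) →
      (∀ j → label (pick j) ≡ j) →
      (∀ x y → label x ≡ label y → proj₁ x ≡ proj₁ y) →
      ∃ P ↔ J
Σ-↔ {P = P} irr label pick label-pick label-injective = mk↔ₛ′ label pick label-pick λ x →
  ext _ _ (label-injective _ _ (label-pick (label x)))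
  where
  ext : (x y : ∃ P) → proj₁ x ≡ proj₁ y → x ≡ y
  ext (a , x) (.a , y) refl = cong (a ,_) (irr x y)

-- Odd numbers

odd-form : ∀ j → Odd j → ∃[ k ] j ≡ suc (k * 2)
odd-form 1             _ = 0 , refl
odd-form (suc (suc j)) o with k , refl ← odd-form j o = suc k , refl

odd-suc-*2 : ∀ k → Odd (suc (k * 2))
odd-suc-*2 zero    = refl
odd-suc-*2 (suc k) = odd-suc-*2 k

odd⇒>0 : ∀ {j} → Odd j → 0 < j
odd⇒>0 {suc _} _ = z<s

2⌊j/2⌋ : ∀ j → Odd j → suc ((j ∸ 1) / 2 * 2) ≡ j
2⌊j/2⌋ j o with k , refl ← odd-form j o = cong (λ i → suc (i * 2)) (m*n/n≡m k 2)

2⌈j/2⌉ : ∀ j → Odd j → (j + 1) / 2 * 2 ≡ suc j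
2⌈j/2⌉ j o with k , refl ← odd-form j o
  rewrite ℕ.+-comm (k * 2) 1 = cong (_* 2) (m*n/n≡m (suc k) 2)

OddUpTo : ℕ → Set
OddUpTo p = ∃[ j ] (Odd j × j ≤ p)

oddUpTo-↔ : ∀ p → OddUpTo p ↔ Fin ((p + 1) / 2)
oddUpTo-↔ p = Σ-↔ irr label pick label-pick label-injective
  where
  irr : ∀ {j} (x y : Odd j × j ≤ p) → x ≡ y
  irr (o , l) (o′ , l′) = cong₂ _,_ (uip o o′) (ℕ.≤-irrelevant l l′)

  half< : ∀ {j} → Odd j → j ≤ p → (j ∸ 1) / 2 < (p + 1) / 2
  -- Since `(j + 1) / 2` is one more than `(j ∸ 1) / 2` for odd `j`, monotonicity of division
  -- already yields the strict bound.
  half< {j} o l = subst (_≤ (p + 1) / 2) ⌈⌉≡suc⌊⌋ (/-monoˡ-≤ 2 (ℕ.+-monoˡ-≤ 1 l))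
    where
    ⌈⌉≡suc⌊⌋ : (j + 1) / 2 ≡ suc ((j ∸ 1) / 2)
    ⌈⌉≡suc⌊⌋ = ℕ.*-cancelʳ-≡ _ _ 2 (trans (2⌈j/2⌉ j o) (cong suc (sym (2⌊j/2⌋ j o))))

  label : OddUpTo p → Fin ((p + 1) / 2)
  label (_ , o , l) = fromℕ< (half< o l)

  pick≤ : (k : Fin ((p + 1) / 2)) → suc (toℕ k * 2) ≤ p
  pick≤ k = ℕ.≤-pred (begin
    suc (toℕ k) * 2  ≤⟨ ℕ.*-monoˡ-≤ 2 (toℕ<n k) ⟩
    (p + 1) / 2 * 2  ≤⟨ m/n*n≤m (p + 1) 2 ⟩
    p + 1            ≡⟨ ℕ.+-comm p 1 ⟩
    suc p            ∎)
    where open ℕ.≤-Reasoning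

  pick : Fin ((p + 1) / 2) → OddUpTo p
  pick k = suc (toℕ k * 2) , odd-suc-*2 (toℕ k) , pick≤ k

  label-pick : ∀ k → label (pick k) ≡ k
  label-pick k = toℕ-injective (trans (toℕ-fromℕ< _) (m*n/n≡m (toℕ k) 2))

  label-injective : ∀ x y → label x ≡ label y → proj₁ x ≡ proj₁ y
  label-injective (j , o , l) (j′ , o′ , l′) eq = begin
    j                        ≡⟨ 2⌊j/2⌋ j o ⟨
    suc ((j ∸ 1) / 2 * 2)    ≡⟨ cong (λ i → suc (i * 2)) half≡ ⟩
    suc ((j′ ∸ 1) / 2 * 2)   ≡⟨ 2⌊j/2⌋ j′ o′ ⟩
    j′                       ∎
    where
    open ≡-Reasoning
    half≡ : (j ∸ 1) / 2 ≡ (j′ ∸ 1) / 2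
    half≡ = trans (sym (toℕ-fromℕ< (half< o l))) (trans (cong toℕ eq) (toℕ-fromℕ< (half< o′ l′)))

-- Arithmetic of residues

mod-∣ : ∀ m n .{{_ : NonZero n}} → + n ∣ + toℕ (m mod n) ℤ.- + m
mod-∣ m n = divides (- + (m / n)) (begin
  + toℕ (m mod n) ℤ.- + m
    ≡⟨ cong₂ (λ r s → + r ℤ.- + s) (toℕ-fromℕ< (m%n<n m n)) (m≡m%n+[m/n]*n m n) ⟩
  + (m % n) ℤ.- (+ (m % n) ℤ.+ + (m / n * n))
    ≡⟨ cong (λ s → + (m % n) ℤ.- (+ (m % n) ℤ.+ s)) (ℤ.pos-* (m / n) n) ⟩
  + (m % n) ℤ.- (+ (m % n) ℤ.+ + (m / n) ℤ.* + n)
    ≡⟨ identity (+ (m % n)) (+ (m / n)) (+ n) ⟩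
  - + (m / n) ℤ.* + n ∎)
  where
  open ≡-Reasoning
  identity : ∀ r d n → r ℤ.- (r ℤ.+ d ℤ.* n) ≡ - d ℤ.* n
  identity = solve-∀

module _ {q : ℕ} .{{_ : NonZero q}} where

  ⊕-∣ : (a b : ℤ/ q) → + q ∣ + toℕ (a ⊕ b) ℤ.- (+ toℕ a ℤ.+ + toℕ b)
  ⊕-∣ a b = mod-∣ (toℕ a + toℕ b) q

  ⊗-∣ : (a b : ℤ/ q) → + q ∣ + toℕ (a ⊗ b) ℤ.- + toℕ a ℤ.* + toℕ b
  ⊗-∣ a b = subst (λ i → + q ∣ + toℕ (a ⊗ b) ℤ.- i) (ℤ.pos-* (toℕ a) (toℕ b))
    (mod-∣ (toℕ a * toℕ b) q)

  infixl 6 _⊖_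

  -- Subtraction shifted by q to stay in `ℕ`; the truncated difference is exact because `toℕ b ≤ q`.
  -- It supplies intercepts of lines and sources of arcs.
  _⊖_ : ℤ/ q → ℤ/ q → ℤ/ q
  a ⊖ b = (toℕ a + (q ∸ toℕ b)) mod q

  ⊖-∣ : (a b : ℤ/ q) → + q ∣ + toℕ (a ⊖ b) ℤ.- (+ toℕ a ℤ.+ (+ q ℤ.- + toℕ b))
  ⊖-∣ a b = subst (λ i → + q ∣ + toℕ (a ⊖ b) ℤ.- (+ toℕ a ℤ.+ i)) q∸b (mod-∣ (toℕ a + (q ∸ toℕ b)) q)
    where
    q∸b : + (q ∸ toℕ b) ≡ + q ℤ.- + toℕ b
    q∸b = trans (sym (ℤ.⊖-≥ (toℕ≤n b))) (sym (ℤ.m-n≡m⊖n q (toℕ b)))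

  ⊖-⊕ : (a b : ℤ/ q) → a ⊖ b ⊕ b ≡ a
  ⊖-⊕ a b = Fin-residue-unique _ _ (subst (+ q ∣_)
    (identity (+ toℕ (a ⊖ b ⊕ b)) (+ toℕ (a ⊖ b)) (+ toℕ a) (+ toℕ b) (+ q))
    -- The last summand, q itself, cancels the shift by q in `_⊖_`.
    (∣m∣n⇒∣m+n (∣m∣n⇒∣m+n (⊕-∣ (a ⊖ b) b) (⊖-∣ a b)) (divides (+ 1) (sym (ℤ.*-identityˡ (+ q))))))
    where
    identity : ∀ s d a b q → (s ℤ.- (d ℤ.+ b)) ℤ.+ (d ℤ.- (a ℤ.+ (q ℤ.- b))) ℤ.+ q ≡ s ℤ.- a
    identity = solve-∀

  ⊕-comm : (a b : ℤ/ q) → a ⊕ b ≡ b ⊕ a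
  ⊕-comm a b = cong (_mod q) (ℕ.+-comm (toℕ a) (toℕ b))

  shift-∣ : (a : ℤ/ q) (k : ℕ) → + q ∣ + toℕ (a ⊕ k mod q) ℤ.- (+ toℕ a ℤ.+ + k)
  shift-∣ a k = subst (+ q ∣_) (identity (+ toℕ (a ⊕ k mod q)) (+ toℕ a) (+ toℕ (k mod q)) (+ k))
    (∣m∣n⇒∣m+n (⊕-∣ a (k mod q)) (mod-∣ k q))
    where
    identity : ∀ s a r k → (s ℤ.- (a ℤ.+ r)) ℤ.+ (r ℤ.- k) ≡ s ℤ.- (a ℤ.+ k)
    identity = solve-∀

  incidence-∣ : (x y m b : ℤ/ q) → y ≡ m ⊗ x ⊕ b →
                + q ∣ + toℕ y ℤ.- (+ toℕ m ℤ.* + toℕ x ℤ.+ + toℕ b)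
  incidence-∣ x y m b refl = subst (+ q ∣_)
    (identity (+ toℕ y) (+ toℕ (m ⊗ x)) (+ toℕ m ℤ.* + toℕ x) (+ toℕ b))
    (∣m∣n⇒∣m+n (⊕-∣ (m ⊗ x) b) (⊗-∣ m x))
    where
    identity : ∀ y t u b → (y ℤ.- (t ℤ.+ b)) ℤ.+ (t ℤ.- u) ≡ y ℤ.- (u ℤ.+ b)
    identity = solve-∀

-- Positions in ℤ/2q

bit : Copy → ℤ
bit unprimed = + 0
bit primed   = + 1

module _ {q : ℕ} where

  -- The copy goes second so that it becomes the low binary digit of the position.
  rank-↔ : (Copy × ℤ/ q) ↔ (ℤ/ q × Fin 2)
  rank-↔ = mk↔ₛ′
    (λ { (unprimed , b) → b , 0F ; (primed , b) → b , 1F })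
    (λ { (b , 0F) → unprimed , b ; (b , 1F) → primed , b })
    (λ { (b , 0F) → refl ; (b , 1F) → refl })
    (λ { (unprimed , b) → refl ; (primed , b) → refl })

  position-↔ : (Copy × ℤ/ q) ↔ ℤ/ (q * 2)
  position-↔ = ↔-trans rank-↔ (↔-sym *↔×)

  position : Copy × ℤ/ q → ℤ
  position r = + toℕ (Inverse.to position-↔ r)

  position-≡ : ∀ c b → position (c , b) ≡ + 2 ℤ.* + toℕ b ℤ.+ bit c
  position-≡ unprimed b =
    trans (cong +_ (toℕ-combine {n = 2} b 0F)) (cong (ℤ._+ + 0) (ℤ.pos-* 2 (toℕ b)))
  position-≡ primed   b =
    trans (cong +_ (toℕ-combine {n = 2} b 1F)) (cong (ℤ._+ + 1) (ℤ.pos-* 2 (toℕ b)))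

  position-unique : ∀ r s → + (q * 2) ∣ position r ℤ.- position s → r ≡ s
  position-unique r s 2q∣ = begin
    r              ≡⟨ strictlyInverseʳ r ⟨
    from (to r)    ≡⟨ cong from (Fin-residue-unique (to r) (to s) 2q∣) ⟩
    from (to s)    ≡⟨ strictlyInverseʳ s ⟩
    s              ∎
    where
    open ≡-Reasoning
    open Inverse position-↔ using (to; from; strictlyInverseʳ)

  slot : GVertex q → ℤ/ q ⊎ ℤ/ q
  slot (_ , point x _) = inj₁ x
  slot (_ , line  m _) = inj₂ m

  rank : GVertex q → Copy × ℤ/ q
  rank (c , point _ y) = c , y
  rank (c , line  _ b) = c , b

  vertex-↔ : GVertex q ↔ ((ℤ/ q ⊎ ℤ/ q) × (Copy × ℤ/ q))
  vertex-↔ = mk↔ₛ′ (λ u → slot u , rank u)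
    (λ { (inj₁ x , c , y) → c , point x y ; (inj₂ m , c , b) → c , line m b })
    (λ { (inj₁ x , c , y) → refl ; (inj₂ m , c , b) → refl })
    (λ { (c , point x y) → refl ; (c , line m b) → refl })

  vertex-ext : ∀ u v → slot u ≡ slot v → rank u ≡ rank v → u ≡ v
  vertex-ext (_ , point _ _) (_ , point _ _) refl refl = refl
  vertex-ext (_ , line  _ _) (_ , line  _ _) refl refl = refl

  ⟦_⟧ : GVertex q → ℤ
  ⟦ u ⟧ = position (rank u)

  -- The criterion by which vertices are identified below: the slot is compared exactly, the
  -- position only modulo 2q.
  vertex-unique : ∀ u v → slot u ≡ slot v → + (q * 2) ∣ ⟦ u ⟧ ℤ.- ⟦ v ⟧ → u ≡ v
  vertex-unique u v slot≡ 2q∣ = vertex-ext u v slot≡ (position-unique (rank u) (rank v) 2q∣)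

-- Edges

module _ {q : ℕ} .{{_ : NonZero q}} where

  edge-sym : ∀ u v → GEdge q u v → GEdge q v u
  edge-sym (_ , point _ _) (_ , line  _ _) (c≡d , e) = sym c≡d , e
  edge-sym (_ , line  _ _) (_ , point _ _) (c≡d , e) = sym c≡d , e

  edge-irrelevant : ∀ u v → (e f : GEdge q u v) → e ≡ f
  edge-irrelevant (_ , point _ _) (_ , line  _ _) (_ , _) (_ , _) = cong₂ _,_ (uip _ _) (uip _ _)
  edge-irrelevant (_ , line  _ _) (_ , point _ _) (_ , _) (_ , _) = cong₂ _,_ (uip _ _) (uip _ _)

  -- Both incidences share `m` and `x`, so y - b is congruent to mx for each of them. Doubling gives
  -- a congruence modulo 2q, and the copy bits cancel because an edge stays within one copy.
  edge-parallel-at-line : ∀ c d m b x y b′ y′ →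
    GEdge q (c , line m b) (c , point x y) → GEdge q (d , line m b′) (d , point x y′) →
    + (q * 2) ∣ (position (d , b′) ℤ.- position (c , b)) ℤ.- (position (d , y′) ℤ.- position (c , y))
  edge-parallel-at-line c d m b x y b′ y′ (_ , e) (_ , e′)
    rewrite position-≡ c b | position-≡ c y | position-≡ d b′ | position-≡ d y′ =
      subst (+ (q * 2) ∣_)
        (identity (+ toℕ y) (+ toℕ y′) (+ toℕ b) (+ toℕ b′) (+ toℕ m) (+ toℕ x) (bit c) (bit d))
        (double-∣ (∣m∣n⇒∣m-n (incidence-∣ x y m b e) (incidence-∣ x y′ m b′ e′)))
    where
    identity : ∀ y y′ b b′ m x c d →
      ((y ℤ.- (m ℤ.* x ℤ.+ b)) ℤ.- (y′ ℤ.- (m ℤ.* x ℤ.+ b′))) ℤ.* + 2 ≡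
      ((+ 2 ℤ.* b′ ℤ.+ d) ℤ.- (+ 2 ℤ.* b ℤ.+ c)) ℤ.- ((+ 2 ℤ.* y′ ℤ.+ d) ℤ.- (+ 2 ℤ.* y ℤ.+ c))
    identity = solve-∀

  edge-parallel : ∀ u v t w → GEdge q u v → GEdge q t w → slot u ≡ slot t → slot v ≡ slot w →
                  + (q * 2) ∣ (⟦ t ⟧ ℤ.- ⟦ u ⟧) ℤ.- (⟦ w ⟧ ℤ.- ⟦ v ⟧)
  edge-parallel (c , line m b) (.c , point x y) (d , line .m b′) (.d , point .x y′)
                (refl , e) (refl , e′) refl refl =
    edge-parallel-at-line c d m b x y b′ y′ (refl , e) (refl , e′)
  edge-parallel u@(c , point x y) v@(.c , line m b) t@(d , point .x y′) w@(.d , line .m b′)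
                (refl , e) (refl , e′) refl refl =
    -- Exchanging the two ends of both edges only changes the sign.
    subst (+ (q * 2) ∣_) (identity (⟦ w ⟧ ℤ.- ⟦ v ⟧) (⟦ t ⟧ ℤ.- ⟦ u ⟧))
      (∣m⇒∣-m (edge-parallel-at-line c d m b x y b′ y′ (refl , e) (refl , e′)))
    where
    identity : ∀ i j → - (i ℤ.- j) ≡ j ℤ.- i
    identity = solve-∀

  -- The two edges are translates of each other, and their common end `u` forces the translation to
  -- be 0.
  neighbour-unique : ∀ u v w → GEdge q u v → GEdge q u w → slot v ≡ slot w → v ≡ w
  neighbour-unique u v w e f slot≡ = vertex-unique v w slot≡ (subst (+ (q * 2) ∣_)
    (identity ⟦ u ⟧ ⟦ v ⟧ ⟦ w ⟧) (edge-parallel u v u w e f refl slot≡))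
    where
    identity : ∀ u v w → (u ℤ.- u) ℤ.- (w ℤ.- v) ≡ v ℤ.- w
    identity = solve-∀

  coordinate : GVertex q → ℤ/ q
  coordinate (_ , point x _) = x
  coordinate (_ , line  m _) = m

  -- All neighbours of a vertex are of the other kind, so the coordinate alone can serve as their
  -- label in the degree count.
  neighbour-slot : ∀ u v w → GEdge q u v → GEdge q u w → coordinate v ≡ coordinate w → slot v ≡ slot w
  neighbour-slot (_ , point _ _) (_ , line  _ _) (_ , line  _ _) _ _ = cong inj₂
  neighbour-slot (_ , line  _ _) (_ , point _ _) (_ , point _ _) _ _ = cong inj₁

  neighbour : ∀ u → ℤ/ q → ∃[ v ] GEdge q u v
  neighbour (c , point x y) m = (c , line m (y ⊖ m ⊗ x)) , refl ,
    trans (sym (⊖-⊕ y (m ⊗ x))) (⊕-comm (y ⊖ m ⊗ x) (m ⊗ x))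
  neighbour (c , line  m b) x = (c , point x (m ⊗ x ⊕ b)) , refl , refl

  coordinate-neighbour : ∀ u i → coordinate (proj₁ (neighbour u i)) ≡ i
  coordinate-neighbour (_ , point _ _) _ = refl
  coordinate-neighbour (_ , line  _ _) _ = refl

  edges-↔ : ∀ u → (∃[ v ] GEdge q u v) ↔ Fin q
  edges-↔ u = Σ-↔ (edge-irrelevant u _)
    (λ (v , _) → coordinate v) (neighbour u) (coordinate-neighbour u)
    (λ (v , e) (w , f) → neighbour-unique u v w e f ∘ neighbour-slot u v w e f)

  common-point-∣ : ∀ x y m b m′ b′ → y ≡ m ⊗ x ⊕ b → y ≡ m′ ⊗ x ⊕ b′ →
    + q ∣ (+ toℕ m ℤ.- + toℕ m′) ℤ.* + toℕ x ℤ.+ (+ toℕ b ℤ.- + toℕ b′)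
  common-point-∣ x y m b m′ b′ e e′ = subst (+ q ∣_)
    (identity (+ toℕ x) (+ toℕ y) (+ toℕ m) (+ toℕ b) (+ toℕ m′) (+ toℕ b′))
    (∣m∣n⇒∣m-n (incidence-∣ x y m′ b′ e′) (incidence-∣ x y m b e))
    where
    identity : ∀ x y m b m′ b′ →
      (y ℤ.- (m′ ℤ.* x ℤ.+ b′)) ℤ.- (y ℤ.- (m ℤ.* x ℤ.+ b)) ≡ (m ℤ.- m′) ℤ.* x ℤ.+ (b ℤ.- b′)
    identity = solve-∀

  -- Two lines through the same two points give q ∣ (m - m′)(x - x′). By Euclid's lemma one factor
  -- vanishes modulo q; the corresponding opposite vertices then share a slot and a neighbour, hence
  -- coincide.
  edges⁴-at-point : Prime q → ∀ c x y v w t → let u = c , point x y in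
    GEdge q u v → GEdge q v w → GEdge q w t → GEdge q t u → u ≡ w ⊎ v ≡ t
  edges⁴-at-point q-prime c x y v@(_ , line m b) w@(_ , point x′ y′) t@(_ , line m′ b′)
                  uv@(_ , e) vw@(_ , f) wt@(_ , g) tu@(_ , h) =
    swap (map same-slope same-abscissa
      (euclidsLemmaℤ q-prime (+ toℕ m ℤ.- + toℕ m′) (+ toℕ x ℤ.- + toℕ x′)
        (affine-difference-∣ (+ toℕ m ℤ.- + toℕ m′) (+ toℕ x) (+ toℕ x′) (+ toℕ b ℤ.- + toℕ b′)
          (common-point-∣ x y m b m′ b′ e h) (common-point-∣ x′ y′ m b m′ b′ f g))))
    where
    same-slope : + q ∣ + toℕ m ℤ.- + toℕ m′ → v ≡ t
    same-slope q∣ = neighbour-unique w v t (edge-sym v w vw) wt (cong inj₂ (Fin-residue-unique m m′ q∣))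
    same-abscissa : + q ∣ + toℕ x ℤ.- + toℕ x′ → (c , point x y) ≡ w
    same-abscissa q∣ = neighbour-unique v (c , point x y) w (edge-sym (c , point x y) v uv) vw
      (cong inj₁ (Fin-residue-unique x x′ q∣))

  edges⁴ : Prime q → ∀ u v w t →
    GEdge q u v → GEdge q v w → GEdge q w t → GEdge q t u → u ≡ w ⊎ v ≡ t
  edges⁴ q-prime (c , point x y) v w t uv vw wt tu = edges⁴-at-point q-prime c x y v w t uv vw wt tu
  edges⁴ q-prime u@(_ , line _ _) (c , point x y) w t uv vw wt tu =
    -- Rotate the walk by one step so that it starts at a point; this exchanges the two pairs of
    -- opposite vertices.
    swap (map₂ sym (edges⁴-at-point q-prime c x y w t u vw wt tu uv))

-- Arcs and closed walks

module _ {p q : ℕ} .{{_ : NonZero q}} where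

  jump : ∀ r s → CArc p q r s → OddUpTo p
  jump (unprimed , _) (primed   , _) (j , o , l , _) = j , o , l
  jump (primed   , _) (unprimed , _) (j , o , l , _) = j , o , l

  -- From the unprimed to the primed copy the position grows by 2(j - 1)/2 + 1, on the way back by
  -- 2(j + 1)/2 - 1. Both equal j, which makes the two kinds of arcs uniform.
  position-jump : ∀ r s (a : CArc p q r s) →
    + (q * 2) ∣ (position s ℤ.- position r) ℤ.- + proj₁ (jump r s a)
  position-jump (unprimed , b) (primed , c) (j , o , _ , refl)
    rewrite position-≡ primed c | position-≡ unprimed b =
      subst (+ (q * 2) ∣_)
        (trans (identity (+ toℕ c) (+ toℕ b) (+ k))
          (cong (λ i → ((+ 2 ℤ.* + toℕ c ℤ.+ + 1) ℤ.- (+ 2 ℤ.* + toℕ b ℤ.+ + 0)) ℤ.- i) 2k+1≡j))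
        (double-∣ (shift-∣ b k))
    where
    k = (j ∸ 1) / 2
    2k+1≡j : + 1 ℤ.+ + k ℤ.* + 2 ≡ + j
    2k+1≡j = trans (cong (λ i → + 1 ℤ.+ i) (sym (ℤ.pos-* k 2))) (cong +_ (2⌊j/2⌋ j o))
    identity : ∀ c b k → (c ℤ.- (b ℤ.+ k)) ℤ.* + 2 ≡
      ((+ 2 ℤ.* c ℤ.+ + 1) ℤ.- (+ 2 ℤ.* b ℤ.+ + 0)) ℤ.- (+ 1 ℤ.+ k ℤ.* + 2)
    identity = solve-∀
  position-jump (primed , b) (unprimed , c) (j , o , _ , refl)
    rewrite position-≡ unprimed c | position-≡ primed b =
      subst (+ (q * 2) ∣_)
        (trans (identity (+ toℕ c) (+ toℕ b) (+ k))
          (cong (λ i → ((+ 2 ℤ.* + toℕ c ℤ.+ + 0) ℤ.- (+ 2 ℤ.* + toℕ b ℤ.+ + 1)) ℤ.- i) 2k-1≡j))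
        (double-∣ (shift-∣ b k))
    where
    k = (j + 1) / 2
    2k-1≡j : + k ℤ.* + 2 ℤ.- + 1 ≡ + j
    2k-1≡j = cong (ℤ._- + 1) (trans (sym (ℤ.pos-* k 2)) (cong +_ (2⌈j/2⌉ j o)))
    identity : ∀ c b k → (c ℤ.- (b ℤ.+ k)) ℤ.* + 2 ≡
      ((+ 2 ℤ.* c ℤ.+ + 0) ℤ.- (+ 2 ℤ.* b ℤ.+ + 1)) ℤ.- (k ℤ.* + 2 ℤ.- + 1)
    identity = solve-∀

  arc-slot : ∀ u v → GArc p q u v → slot u ≡ slot v
  arc-slot (_ , point _ _) (_ , point _ _) (x≡w , _) = cong inj₁ x≡w
  arc-slot (_ , line  _ _) (_ , line  _ _) (m≡n , _) = cong inj₂ m≡n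

  arc-rank : ∀ u v → GArc p q u v → CArc p q (rank u) (rank v)
  arc-rank (_ , point _ _) (_ , point _ _) (_ , a) = a
  arc-rank (_ , line  _ _) (_ , line  _ _) (_ , a) = a

  arc-jump : ∀ u v → GArc p q u v → OddUpTo p
  arc-jump u v a = jump (rank u) (rank v) (arc-rank u v a)

  ⟦⟧-jump : ∀ u v (a : GArc p q u v) → + (q * 2) ∣ (⟦ v ⟧ ℤ.- ⟦ u ⟧) ℤ.- + proj₁ (arc-jump u v a)
  ⟦⟧-jump u v a = position-jump (rank u) (rank v) (arc-rank u v a)

  out-arc : ∀ u → OddUpTo p → ∃[ v ] GArc p q u v
  out-arc (unprimed , point x y) (j , o , l) =
    (primed   , point x (y ⊕ ((j ∸ 1) / 2) mod q)) , refl , j , o , l , refl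
  out-arc (primed   , point x y) (j , o , l) =
    (unprimed , point x (y ⊕ ((j + 1) / 2) mod q)) , refl , j , o , l , refl
  out-arc (unprimed , line  m b) (j , o , l) =
    (primed   , line  m (b ⊕ ((j ∸ 1) / 2) mod q)) , refl , j , o , l , refl
  out-arc (primed   , line  m b) (j , o , l) =
    (unprimed , line  m (b ⊕ ((j + 1) / 2) mod q)) , refl , j , o , l , refl

  -- The shift is chosen by the copy of the source, hence the halvings are swapped compared with
  -- `out-arc`.
  in-arc : ∀ v → OddUpTo p → ∃[ u ] GArc p q u v
  in-arc (unprimed , point x y) (j , o , l) =
    (primed   , point x (y ⊖ ((j + 1) / 2) mod q)) , refl , j , o , l , sym (⊖-⊕ y _)
  in-arc (primed   , point x y) (j , o , l) =
    (unprimed , point x (y ⊖ ((j ∸ 1) / 2) mod q)) , refl , j , o , l , sym (⊖-⊕ y _)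
  in-arc (unprimed , line  m b) (j , o , l) =
    (primed   , line  m (b ⊖ ((j + 1) / 2) mod q)) , refl , j , o , l , sym (⊖-⊕ b _)
  in-arc (primed   , line  m b) (j , o , l) =
    (unprimed , line  m (b ⊖ ((j ∸ 1) / 2) mod q)) , refl , j , o , l , sym (⊖-⊕ b _)

  arc-jump-out : ∀ u j → arc-jump u _ (proj₂ (out-arc u j)) ≡ j
  arc-jump-out (unprimed , point _ _) _ = refl
  arc-jump-out (primed   , point _ _) _ = refl
  arc-jump-out (unprimed , line  _ _) _ = refl
  arc-jump-out (primed   , line  _ _) _ = refl

  arc-jump-in : ∀ v j → arc-jump _ v (proj₂ (in-arc v j)) ≡ j
  arc-jump-in (unprimed , point _ _) _ = refl
  arc-jump-in (primed   , point _ _) _ = refl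
  arc-jump-in (unprimed , line  _ _) _ = refl
  arc-jump-in (primed   , line  _ _) _ = refl

  -- For the degree count: the source and the jump fix the target's slot and its position modulo 2q.
  target-unique : ∀ u v w (a : GArc p q u v) (b : GArc p q u w) →
                  arc-jump u v a ≡ arc-jump u w b → v ≡ w
  target-unique u v w a b jump≡ = vertex-unique v w (trans (sym (arc-slot u v a)) (arc-slot u w b))
    (subst (+ (q * 2) ∣_) (identity ⟦ u ⟧ ⟦ v ⟧ ⟦ w ⟧ (+ proj₁ (arc-jump u w b)))
      (∣m∣n⇒∣m-n
        (subst (λ j → + (q * 2) ∣ (⟦ v ⟧ ℤ.- ⟦ u ⟧) ℤ.- + proj₁ j) jump≡ (⟦⟧-jump u v a))
        (⟦⟧-jump u w b)))
    where
    identity : ∀ u v w j → ((v ℤ.- u) ℤ.- j) ℤ.- ((w ℤ.- u) ℤ.- j) ≡ v ℤ.- w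
    identity = solve-∀

  source-unique : ∀ u v w (a : GArc p q u w) (b : GArc p q v w) →
                  arc-jump u w a ≡ arc-jump v w b → u ≡ v
  source-unique u v w a b jump≡ = vertex-unique u v (trans (arc-slot u w a) (sym (arc-slot v w b)))
    (subst (+ (q * 2) ∣_) (identity ⟦ u ⟧ ⟦ v ⟧ ⟦ w ⟧ (+ proj₁ (arc-jump v w b)))
      (∣m∣n⇒∣m-n
        (⟦⟧-jump v w b)
        (subst (λ j → + (q * 2) ∣ (⟦ w ⟧ ℤ.- ⟦ u ⟧) ℤ.- + proj₁ j) jump≡ (⟦⟧-jump u w a))))
    where
    identity : ∀ u v w j → ((w ℤ.- v) ℤ.- j) ℤ.- ((w ℤ.- u) ℤ.- j) ≡ u ℤ.- v
    identity = solve-∀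

  -- Parity invariants of closed walks

  kind : GVertex q → Parity
  kind (_ , point _ _) = 0ℙ
  kind (_ , line  _ _) = 1ℙ

  kind-edge : ∀ u v → GEdge q u v → kind v ≡ kind u ⁻¹
  kind-edge (_ , point _ _) (_ , line  _ _) _ = refl
  kind-edge (_ , line  _ _) (_ , point _ _) _ = refl

  kind-arc : ∀ u v → GArc p q u v → kind v ≡ kind u
  kind-arc (_ , point _ _) (_ , point _ _) _ = refl
  kind-arc (_ , line  _ _) (_ , line  _ _) _ = refl

  copyParity : Copy → Parity
  copyParity unprimed = 0ℙ
  copyParity primed   = 1ℙ

  copy : GVertex q → Parity
  copy u = copyParity (proj₁ (rank u))

  copy-edge : ∀ u v → GEdge q u v → copy v ≡ copy u
  copy-edge (_ , point _ _) (_ , line  _ _) (c≡d , _) = cong copyParity (sym c≡d)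
  copy-edge (_ , line  _ _) (_ , point _ _) (c≡d , _) = cong copyParity (sym c≡d)

  copyParity-jump : ∀ r s → CArc p q r s → copyParity (proj₁ s) ≡ copyParity (proj₁ r) ⁻¹
  copyParity-jump (unprimed , _) (primed   , _) _ = refl
  copyParity-jump (primed   , _) (unprimed , _) _ = refl

  copy-arc : ∀ u v → GArc p q u v → copy v ≡ copy u ⁻¹
  copy-arc u v a = copyParity-jump (rank u) (rank v) (arc-rank u v a)

  -- Edges flip `kind` and keep `copy`, arcs do the opposite; the sum therefore flips at every step,
  -- and `G[ p , q ]` is bipartite.
  colour : GVertex q → Parity
  colour u = kind u ℙ+ copy u

  colour-step : ∀ u v → Step G[ p , q ] u v → colour v ≡ colour u ⁻¹
  colour-step u v (along-arc a) =
    trans (cong₂ _ℙ+_ (kind-arc u v a) (copy-arc u v a)) (+-⁻¹ (kind u) (copy u))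
    where
    +-⁻¹ : ∀ x y → x ℙ+ y ⁻¹ ≡ (x ℙ+ y) ⁻¹
    +-⁻¹ 0ℙ y = refl
    +-⁻¹ 1ℙ y = refl
  colour-step u v (along-edge e) =
    trans (cong₂ _ℙ+_ (kind-edge u v e) (copy-edge u v e)) (⁻¹-+ (kind u) (copy u))
    where
    ⁻¹-+ : ∀ x y → x ⁻¹ ℙ+ y ≡ (x ℙ+ y) ⁻¹
    ⁻¹-+ 0ℙ y = refl
    ⁻¹-+ 1ℙ y = sym (⁻¹-involutive y)

  no-arc-loop : ∀ u → ¬ GArc p q u u
  no-arc-loop u a = p≢p⁻¹ (copy u) (copy-arc u u a)

  no-edge-loop : ∀ u → ¬ GEdge q u u
  no-edge-loop u e = p≢p⁻¹ (kind u) (kind-edge u u e)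

  no-arc-∥-edge : ∀ u v → GArc p q u v → ¬ GEdge q u v
  no-arc-∥-edge u v a e = p≢p⁻¹ (kind u) (trans (sym (kind-arc u v a)) (kind-edge u v e))

  no-closed-1-walk : ∀ u → ¬ Step G[ p , q ] u u
  no-closed-1-walk u s = p≢p⁻¹ (colour u) (colour-step u u s)

  no-closed-3-walk : ∀ u v w → Step G[ p , q ] u v → Step G[ p , q ] v w → ¬ Step G[ p , q ] w u
  no-closed-3-walk u v w a b c = p≢p⁻¹ (colour u) (begin
    colour u             ≡⟨ colour-step w u c ⟩
    colour w ⁻¹          ≡⟨ cong _⁻¹ (colour-step v w b) ⟩
    colour v ⁻¹ ⁻¹       ≡⟨ ⁻¹-involutive (colour v) ⟩
    colour v             ≡⟨ colour-step u v a ⟩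
    colour u ⁻¹          ∎)
    where open ≡-Reasoning

  no-closed-5-walk : ∀ t u v w x → Step G[ p , q ] t u → Step G[ p , q ] u v → Step G[ p , q ] v w →
                     Step G[ p , q ] w x → ¬ Step G[ p , q ] x t
  no-closed-5-walk t u v w x a b c d e = p≢p⁻¹ (colour t) (begin
    colour t             ≡⟨ colour-step x t e ⟩
    colour x ⁻¹          ≡⟨ cong _⁻¹ (colour-step w x d) ⟩
    colour w ⁻¹ ⁻¹       ≡⟨ ⁻¹-involutive (colour w) ⟩
    colour w             ≡⟨ colour-step v w c ⟩
    colour v ⁻¹          ≡⟨ cong _⁻¹ (colour-step u v b) ⟩
    colour u ⁻¹ ⁻¹       ≡⟨ ⁻¹-involutive (colour u) ⟩
    colour u             ≡⟨ colour-step t u a ⟩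
    colour t ⁻¹          ∎)
    where open ≡-Reasoning

  -- `kind` would return to its value after three flips. The next lemma is the same with a single
  -- flip.
  no-edges³-arc : ∀ u v w x → GEdge q u v → GEdge q v w → GEdge q w x → ¬ GArc p q x u
  no-edges³-arc u v w x e f g a = p≢p⁻¹ (kind u) (begin
    kind u               ≡⟨ kind-arc x u a ⟩
    kind x               ≡⟨ kind-edge w x g ⟩
    kind w ⁻¹            ≡⟨ cong _⁻¹ (kind-edge v w f) ⟩
    kind v ⁻¹ ⁻¹         ≡⟨ ⁻¹-involutive (kind v) ⟩
    kind v               ≡⟨ kind-edge u v e ⟩
    kind u ⁻¹            ∎)
    where open ≡-Reasoning

  no-edge-arcs³ : ∀ u v w x → GEdge q u v → GArc p q v w → GArc p q w x → ¬ GArc p q x u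
  no-edge-arcs³ u v w x e a b c = p≢p⁻¹ (kind u) (begin
    kind u               ≡⟨ kind-arc x u c ⟩
    kind x               ≡⟨ kind-arc w x b ⟩
    kind w               ≡⟨ kind-arc v w a ⟩
    kind v               ≡⟨ kind-edge u v e ⟩
    kind u ⁻¹            ∎)
    where open ≡-Reasoning

  -- The arcs keep the slot, so `u` and `w` are neighbours of `v` in the same slot.
  edges²-arcs² : ∀ u v w x → GEdge q u v → GEdge q v w → GArc p q w x → GArc p q x u → u ≡ w
  edges²-arcs² u v w x e f a b = neighbour-unique v u w (edge-sym u v e) f
    (sym (trans (arc-slot w x a) (arc-slot x u b)))

  -- Excluding short cycles when 2p < q

  module _ (p+p<q : p + p < q) where

    p+p<q*2 : p + p < q * 2
    p+p<q*2 = ℕ.<-≤-trans p+p<q (ℕ.m≤m*n q 2)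

    p<q*2 : p < q * 2
    p<q*2 = ℕ.≤-<-trans (ℕ.m≤m+n p p) p+p<q*2

    ¬∣-jumps² : (a b : OddUpTo p) → ¬ (+ (q * 2) ∣ + (proj₁ a + proj₁ b))
    ¬∣-jumps² (j , o , j≤p) (k , _ , k≤p) 2q∣ = ℕ.>⇒≢ (ℕ.<-≤-trans (odd⇒>0 o) (ℕ.m≤m+n j k))
      (∣⇒≡0 (∣⇒∣ᵤ 2q∣) (ℕ.≤-<-trans (ℕ.+-mono-≤ j≤p k≤p) p+p<q*2))

    ¬∣-jumps⁴ : (a b c d : OddUpTo p) →
                ¬ (+ (q * 2) ∣ + ((proj₁ a + proj₁ b) + (proj₁ c + proj₁ d)))
    ¬∣-jumps⁴ (j , o , j≤p) (k , _ , k≤p) (l , _ , l≤p) (m , _ , m≤p) 2q∣ =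
      ℕ.>⇒≢ (ℕ.<-≤-trans (odd⇒>0 o) (ℕ.≤-trans (ℕ.m≤m+n j k) (ℕ.m≤m+n (j + k) (l + m))))
        (∣⇒≡0 (∣⇒∣ᵤ 2q∣) (begin-strict
          (j + k) + (l + m)  ≤⟨ ℕ.+-mono-≤ (ℕ.+-mono-≤ j≤p k≤p) (ℕ.+-mono-≤ l≤p m≤p) ⟩
          (p + p) + (p + p)  <⟨ ℕ.+-mono-< p+p<q p+p<q ⟩
          q + q              ≡⟨ cong (λ i → q + i) (ℕ.+-identityʳ q) ⟨
          2 * q              ≡⟨ ℕ.*-comm 2 q ⟩
          q * 2              ∎))
      where open ℕ.≤-Reasoning

    -- Both jumps are congruent modulo 2q to the same difference of positions and are below 2q, so
    -- the endpoints determine j.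
    carc-irrelevant : ∀ r s → (a b : CArc p q r s) → a ≡ b
    carc-irrelevant r s a b = ext r s a b (residue-unique (jump< a) (jump< b)
      (subst (+ (q * 2) ∣_) (identity (position s ℤ.- position r) (+ proj₁ (jump r s a))
                                (+ proj₁ (jump r s b)))
        (∣m∣n⇒∣m-n (position-jump r s b) (position-jump r s a))))
      where
      jump< : (a : CArc p q r s) → proj₁ (jump r s a) < q * 2
      jump< a = ℕ.≤-<-trans (proj₂ (proj₂ (jump r s a))) p<q*2
      identity : ∀ d j k → (d ℤ.- k) ℤ.- (d ℤ.- j) ≡ j ℤ.- k
      identity = solve-∀
      fields : ∀ {j} {A : Set} {x y : A} (a b : Odd j × j ≤ p × x ≡ y) → a ≡ b
      fields (o , l , e) (o′ , l′ , e′) =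
        cong₂ _,_ (uip o o′) (cong₂ _,_ (ℕ.≤-irrelevant l l′) (uip e e′))
      ext : ∀ r s (a b : CArc p q r s) → proj₁ (jump r s a) ≡ proj₁ (jump r s b) → a ≡ b
      ext (unprimed , _) (primed   , _) (j , a) (.j , b) refl = cong (j ,_) (fields a b)
      ext (primed   , _) (unprimed , _) (j , a) (.j , b) refl = cong (j ,_) (fields a b)

    arc-irrelevant : ∀ u v → (a b : GArc p q u v) → a ≡ b
    arc-irrelevant (c , point _ y) (d , point _ y′) (_ , a) (_ , b) =
      cong₂ _,_ (uip _ _) (carc-irrelevant (c , y) (d , y′) a b)
    arc-irrelevant (c , line  _ y) (d , line  _ y′) (_ , a) (_ , b) =
      cong₂ _,_ (uip _ _) (carc-irrelevant (c , y) (d , y′) a b)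

    outArcs-↔ : ∀ u → (∃[ v ] GArc p q u v) ↔ OddUpTo p
    outArcs-↔ u = Σ-↔ (arc-irrelevant u _) (λ (v , a) → arc-jump u v a) (out-arc u) (arc-jump-out u)
      (λ (v , a) (w , b) → target-unique u v w a b)

    inArcs-↔ : ∀ v → (∃[ u ] GArc p q u v) ↔ OddUpTo p
    inArcs-↔ v = Σ-↔ (arc-irrelevant _ v) (λ (u , a) → arc-jump u v a) (in-arc v) (arc-jump-in v)
      (λ (u , a) (w , b) → source-unique u w v a b)

    simple : IsSimple G[ p , q ]
    simple = record
      { finite            = _ , ↔-trans vertex-↔ (↔-trans (↔-sym +↔⊎ ×-↔ position-↔) (↔-sym *↔×))
      ; edge-sym          = edge-sym _ _
      ; no-edge-loop      = λ { refl → no-edge-loop _ }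
      ; no-arc-loop       = λ { refl → no-arc-loop _ }
      ; no-parallel-edges = edge-irrelevant _ _
      ; no-parallel-arcs  = arc-irrelevant _ _
      ; no-arc-∥-edge     = no-arc-∥-edge _ _
      }

    -- Differences of positions telescope to 0 around the walk, so the jumps would sum to a multiple
    -- of 2q. The same argument serves for four arcs.
    no-arcs² : ∀ u v → GArc p q u v → ¬ GArc p q v u
    no-arcs² u v a b = ¬∣-jumps² (arc-jump u v a) (arc-jump v u b) (subst (+ (q * 2) ∣_)
      (identity ⟦ u ⟧ ⟦ v ⟧ (+ proj₁ (arc-jump u v a)) (+ proj₁ (arc-jump v u b)))
      (∣m⇒∣-m (∣m∣n⇒∣m+n (⟦⟧-jump u v a) (⟦⟧-jump v u b))))
      where
      identity : ∀ u v j k → - ((v ℤ.- u) ℤ.- j ℤ.+ ((u ℤ.- v) ℤ.- k)) ≡ j ℤ.+ k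
      identity = solve-∀

    no-arcs⁴ : ∀ u v w x → GArc p q u v → GArc p q v w → GArc p q w x → ¬ GArc p q x u
    no-arcs⁴ u v w x a b c d =
      ¬∣-jumps⁴ (arc-jump u v a) (arc-jump v w b) (arc-jump w x c) (arc-jump x u d) (subst (+ (q * 2) ∣_)
        (identity ⟦ u ⟧ ⟦ v ⟧ ⟦ w ⟧ ⟦ x ⟧ (+ proj₁ (arc-jump u v a)) (+ proj₁ (arc-jump v w b))
          (+ proj₁ (arc-jump w x c)) (+ proj₁ (arc-jump x u d)))
        (∣m⇒∣-m (∣m∣n⇒∣m+n (∣m∣n⇒∣m+n (⟦⟧-jump u v a) (⟦⟧-jump v w b))
                           (∣m∣n⇒∣m+n (⟦⟧-jump w x c) (⟦⟧-jump x u d)))))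
      where
      identity : ∀ u v w x j k l m →
        - (((v ℤ.- u) ℤ.- j ℤ.+ ((w ℤ.- v) ℤ.- k)) ℤ.+ ((x ℤ.- w) ℤ.- l ℤ.+ ((u ℤ.- x) ℤ.- m))) ≡
        (j ℤ.+ k) ℤ.+ (l ℤ.+ m)
      identity = solve-∀

    -- The arcs keep slots, so both edges join the same two slots and are parallel: x - u is
    -- congruent to w - v. Going around, the edges cancel and the two jumps sum to 0 modulo 2q.
    no-alternating⁴ : ∀ u v w x → GEdge q u v → GArc p q v w → GEdge q w x → ¬ GArc p q x u
    no-alternating⁴ u v w x e a f b = ¬∣-jumps² (arc-jump v w a) (arc-jump x u b) (subst (+ (q * 2) ∣_)
      (identity ⟦ u ⟧ ⟦ v ⟧ ⟦ w ⟧ ⟦ x ⟧ (+ proj₁ (arc-jump v w a)) (+ proj₁ (arc-jump x u b)))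
      (∣m⇒∣-m (∣m∣n⇒∣m+n (∣m∣n⇒∣m+n (⟦⟧-jump v w a) (⟦⟧-jump x u b))
        (edge-parallel u v x w e (edge-sym w x f) (sym (arc-slot x u b)) (arc-slot v w a)))))
      where
      identity : ∀ u v w x j k →
        - (((w ℤ.- v) ℤ.- j ℤ.+ ((u ℤ.- x) ℤ.- k)) ℤ.+ ((x ℤ.- u) ℤ.- (w ℤ.- v))) ≡ j ℤ.+ k
      identity = solve-∀

    -- Traversing one edge back and forth is a closed walk, so the case of two edges is left to
    -- `no-backtrack`; the double negation has the shape in which that field refutes it.
    no-closed-2-walk : ∀ u v (s : Step G[ p , q ] u v) (t : Step G[ p , q ] v u) →
                       ¬ ¬ (IsEdgeStep s × IsEdgeStep t)
    no-closed-2-walk u v (along-arc a) (along-arc b) _ = no-arcs² u v a b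
    no-closed-2-walk u v (along-arc a) (along-edge e) _ = no-arc-∥-edge u v a (edge-sym v u e)
    no-closed-2-walk u v (along-edge e) (along-arc a) _ = no-arc-∥-edge v u a (edge-sym u v e)
    no-closed-2-walk u v (along-edge e) (along-edge f) ¬ee = ¬ee (is-edge e , is-edge f)

    -- An odd number of edges contradicts `kind`. Up to rotation there remain four arcs and the
    -- alternating pattern, both impossible, and two adjacent edges or four edges, which force
    -- opposite vertices to coincide.
    closed-4-walk : Prime q → ∀ u v w x →
      Step G[ p , q ] u v → Step G[ p , q ] v w → Step G[ p , q ] w x → Step G[ p , q ] x u →
      u ≡ w ⊎ v ≡ x
    closed-4-walk _ u v w x (along-arc a) (along-arc b) (along-arc c) (along-arc d) =
      contradiction d (no-arcs⁴ u v w x a b c)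
    closed-4-walk _ u v w x (along-arc a) (along-arc b) (along-arc c) (along-edge d) =
      contradiction c (no-edge-arcs³ x u v w d a b)
    closed-4-walk _ u v w x (along-arc a) (along-arc b) (along-edge c) (along-arc d) =
      contradiction b (no-edge-arcs³ w x u v c d a)
    closed-4-walk _ u v w x (along-arc a) (along-arc b) (along-edge c) (along-edge d) =
      inj₁ (sym (edges²-arcs² w x u v c d a b))
    closed-4-walk _ u v w x (along-arc a) (along-edge b) (along-arc c) (along-arc d) =
      contradiction a (no-edge-arcs³ v w x u b c d)
    closed-4-walk _ u v w x (along-arc a) (along-edge b) (along-arc c) (along-edge d) =
      contradiction a (no-alternating⁴ v w x u b c d)
    closed-4-walk _ u v w x (along-arc a) (along-edge b) (along-edge c) (along-arc d) =
      inj₂ (edges²-arcs² v w x u b c d a)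
    closed-4-walk _ u v w x (along-arc a) (along-edge b) (along-edge c) (along-edge d) =
      contradiction a (no-edges³-arc v w x u b c d)
    closed-4-walk _ u v w x (along-edge a) (along-arc b) (along-arc c) (along-arc d) =
      contradiction d (no-edge-arcs³ u v w x a b c)
    closed-4-walk _ u v w x (along-edge a) (along-arc b) (along-arc c) (along-edge d) =
      inj₂ (sym (edges²-arcs² x u v w d a b c))
    closed-4-walk _ u v w x (along-edge a) (along-arc b) (along-edge c) (along-arc d) =
      contradiction d (no-alternating⁴ u v w x a b c)
    closed-4-walk _ u v w x (along-edge a) (along-arc b) (along-edge c) (along-edge d) =
      contradiction b (no-edges³-arc w x u v c d a)
    closed-4-walk _ u v w x (along-edge a) (along-edge b) (along-arc c) (along-arc d) =
      inj₁ (edges²-arcs² u v w x a b c d)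
    closed-4-walk _ u v w x (along-edge a) (along-edge b) (along-arc c) (along-edge d) =
      contradiction c (no-edges³-arc x u v w d a b)
    closed-4-walk _ u v w x (along-edge a) (along-edge b) (along-edge c) (along-arc d) =
      contradiction d (no-edges³-arc u v w x a b c)
    closed-4-walk q-prime u v w x (along-edge a) (along-edge b) (along-edge c) (along-edge d) =
      edges⁴ q-prime u v w x a b c d

    no-short-cycle : Prime q → ∀ {n} → Cycle G[ p , q ] n → 6 ≤ n
    no-short-cycle _ {0} record { n≢0 = n≢0 } = contradiction refl (≢-nonZero⁻¹ 0 {{n≢0}})
    no-short-cycle _ {1} C = contradiction (step 0F) (no-closed-1-walk _)
      where open Cycle C
    -- In `Fin 2`, `next (next 0F)` computes to `0F`, so `refl` exhibits the backtracking.
    no-short-cycle _ {2} C = contradiction (λ (e , f) → no-backtrack 0F e f refl)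
                               (no-closed-2-walk _ _ (step 0F) (step 1F))
      where open Cycle C
    no-short-cycle _ {3} C = contradiction (step 2F)
                               (no-closed-3-walk _ _ _ (step 0F) (step 1F))
      where open Cycle C
    no-short-cycle q-prime {4} C
      with closed-4-walk q-prime _ _ _ _ (step 0F) (step 1F) (step 2F) (step 3F)
      where open Cycle C
    ... | inj₁ v₀≡v₂ with () ← Cycle.distinct C v₀≡v₂
    ... | inj₂ v₁≡v₃ with () ← Cycle.distinct C v₁≡v₃
    no-short-cycle _ {5} C = contradiction (step 4F)
      (no-closed-5-walk _ _ _ _ _ (step 0F) (step 1F) (step 2F) (step 3F))
      where open Cycle C
    no-short-cycle _ {suc (suc (suc (suc (suc (suc n)))))} _ = s≤s (s≤s (s≤s (s≤s (s≤s (s≤s z≤n)))))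

-- A cycle of length six

next²≢id : ∀ (i : Fin 6) → next (next i) ≢ i
next²≢id 0F ()
next²≢id 1F ()
next²≢id 2F ()
next²≢id 3F ()
next²≢id 4F ()
next²≢id 5F ()

-- The triangle of the lines y = 2x, y = 2 and y = x with corners (0, 0), (1, 2) and (2, 2). All
-- values stay below 3, so no reduction modulo q = 3 + r occurs and the incidences hold by
-- computation.
hexagon : ∀ p {q} .{{_ : NonZero q}} → 3 ≤ q → Cycle G[ p , q ] 6
hexagon p {q = suc (suc (suc r))} (s≤s (s≤s (s≤s _))) = record
  { vertex       = vertex
  ; distinct     = vertex-injective
  ; step         = step
  ; no-backtrack = λ i _ _ v≡ → next²≢id i (vertex-injective v≡)
  }
  where
  vertex : Fin 6 → GVertex (3 + r)
  vertex 0F = unprimed , point 0F 0F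
  vertex 1F = unprimed , line  2F 0F
  vertex 2F = unprimed , point 1F 2F
  vertex 3F = unprimed , line  0F 2F
  vertex 4F = unprimed , point 2F 2F
  vertex 5F = unprimed , line  1F 0F

  -- A left inverse of `vertex`: the corners have distinct abscissae and the sides distinct slopes.
  index : GVertex (3 + r) → Fin 6
  index (_ , point 0F _) = 0F
  index (_ , point 1F _) = 2F
  index (_ , point _  _) = 4F
  index (_ , line  0F _) = 3F
  index (_ , line  1F _) = 5F
  index (_ , line  _  _) = 1F

  index-vertex : ∀ i → index (vertex i) ≡ i
  index-vertex 0F = refl
  index-vertex 1F = refl
  index-vertex 2F = refl
  index-vertex 3F = refl
  index-vertex 4F = refl
  index-vertex 5F = refl

  vertex-injective : ∀ {i j} → vertex i ≡ vertex j → i ≡ j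
  vertex-injective {i} {j} v≡ = trans (sym (index-vertex i)) (trans (cong index v≡) (index-vertex j))

  step : ∀ i → Step G[ p , 3 + r ] (vertex i) (vertex (next i))
  step 0F = along-edge (refl , refl)
  step 1F = along-edge (refl , refl)
  step 2F = along-edge (refl , refl)
  step 3F = along-edge (refl , refl)
  step 4F = along-edge (refl , refl)
  step 5F = along-edge (refl , refl)

-- Supplies the bound `p + p < q` on which the exclusion of short cycles rests.
half+half<q : ∀ q → 0 < q → (q ∸ 1) / 2 + (q ∸ 1) / 2 < q
half+half<q (suc r) _ = s≤s (begin
  r / 2 + r / 2        ≡⟨ cong (λ i → r / 2 + i) (ℕ.+-identityʳ (r / 2)) ⟨
  2 * (r / 2)          ≡⟨ ℕ.*-comm 2 (r / 2) ⟩
  r / 2 * 2            ≤⟨ m/n*n≤m r 2 ⟩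
  r                    ∎)
  where open ℕ.≤-Reasoning

theorem4 : ∀ (p q : ℕ) (q-prime : Prime q) → 3 ≤ q → p ≡ (q ∸ 1) / 2 → Odd p →
    Is[ (p + 1) / 2 , q ⨾ 6 ]-MixedGraph (G[_,_] p q {{prime⇒nonZero q-prime}})
theorem4 p q q-prime 3≤q refl _ = record
  { simple  = simple p+p<q
  ; inArcs  = λ v → ↔-trans (inArcs-↔ p+p<q v) (oddUpTo-↔ p)
  ; outArcs = λ v → ↔-trans (outArcs-↔ p+p<q v) (oddUpTo-↔ p)
  ; edges   = edges-↔
  ; girth   = record
    { attained = hexagon p 3≤q
    ; shortest = no-short-cycle p+p<q q-prime
    }
  }
  where
  instance _ = prime⇒nonZero q-prime
  p+p<q : p + p < q
  p+p<q = half+half<q q (ℕ.≤-trans (s≤s z≤n) 3≤q)
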